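{- For any unimodal range map $\delta$, the quotient space $\mathbf{Cl}_{\bar{\delta}}/\mathcal{V}_\delta$ (with the partial compositions and unit induced from $\mathbf{Cl}_{\bar\delta}$) is an operad.
   Context: $\mathbb{N}=\{0,1,2,\dots\}$ and $\mathbb{K}$ is a field of characteristic zero. Operads are nonsymmetric operads in $\mathbb{K}$-vector spaces, with partial compositions $\circ_i$ and a unit. A range map is a map $\delta:\mathbb{N}\setminus\{0\}\to\mathbb{N}$. It is unimodal if there are no $1\le i_1<i_2<i_3$ with $\delta(i_1)>\delta(i_2)<\delta(i_3)$. For a range map $\delta$, let $\bar{\delta}$ be the (weakly increasing) range map $\bar{\delta}(i):=\max\{\delta(1),\dots,\delta(i)\}$. For a word $w$ on $\mathbb{N}$, $\ell(w)$ is its length, $w(i)$ its $i$-th letter, and $\epsilon$ is the empty word. A $\delta$-cliff is a word $w$ on $\mathbb{N}$ such that $0\le w(i)\le\delta(i)$ for all $1\le i\le\ell(w)$. Its size is $|w|:=\ell(w)+1$. $\mathsf{Cl}_\delta$ is the graded set (by size) of all $\delta$-cliffs; note $\mathsf{Cl}_\delta\subseteq\mathsf{Cl}_{\bar\delta}$. For words $u,v$ and $1\le i\le |u|$, set $u\,\square_i\,v:=u(1)\cdots u(i-1)\;v\;u(i)\cdots u(\ell(u))$. For a weakly increasing range map $\rho$, $\mathbf{Cl}_\rho$ is the operad with basis $\{\mathsf{E}_w:w\in\mathsf{Cl}_\rho\}$, where $\mathsf{E}_w$ has arity $|w|$, partial compositions given by $\mathsf{E}_u\circ_i\mathsf{E}_v:=\mathsf{E}_{u\,\square_i\,v}$,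 and unit $\mathsf{E}_\epsilon$. $\mathcal{V}_\delta$ is the graded subspace of $\mathbf{Cl}_{\bar\delta}$ spanned by $\{\mathsf{E}_w: w\in\mathsf{Cl}_{\bar\delta}\setminus\mathsf{Cl}_\delta\}$. -}

module Defs where

open import Algebra.Apartness.Bundles using (HeytingCommutativeRing; HeytingField)
open import Algebra.Bundles using (CommutativeMonoid; CommutativeRing)
open import Algebra.Module.Bundles using (Module)
open import Algebra.Module.Structures.Biased using (IsModuleFromLeft)
open import Data.Bool.Base using (true; false; if_then_else_)
open import Data.Fin.Base as Fin using (Fin; toℕ)
open import Data.List.Base
  using (List; []; _∷_; [_]; _++_; map; length; lookup; take; drop; applyUpTo; cartesianProductWith)
open import Data.List.Extrema.Nat using (max; max≤v⁺; v≤max⁺)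
open import Data.List.Properties
  using (≡-dec; length-++)
import Data.List.Relation.Unary.All.Properties as All
import Data.List.Relation.Unary.Any.Properties as Any
open import Data.Nat.Base using (ℕ; zero; suc)
import Data.Nat.Properties as ℕ
open import Data.Product.Base using (_×_; _,_; Σ-syntax)
open import Data.Sum.Base using (inj₂)
open import Function.Base using (flip)
open import Level using (Level; _⊔_; 0ℓ) renaming (suc to lsuc)
open import Relation.Binary.Bundles using (DecSetoid)
import Relation.Binary.Construct.On as On
open import Relation.Binary.PropositionalEquality
  using (_≡_; refl; sym; trans; cong; cong₂; module ≡-Reasoning)
import Relation.Binary.PropositionalEquality.Properties as ≡
import Relation.Binary.Reasoning.Setoid as SetoidReasoning
open import Relation.Nullary using (¬_; does)
open import Relation.Unary using (Pred)

private
  variable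
    c ℓ ℓ₁ ℓ₂ m ℓm p b ℓb b₁ b₂ b₃ ℓb₁ ℓb₂ ℓb₃ : Level

HeytingField⇒CommutativeRing : HeytingField c ℓ₁ ℓ₂ → CommutativeRing c ℓ₁
HeytingField⇒CommutativeRing K =
  HeytingCommutativeRing.commutativeRing (HeytingField.heytingCommutativeRing K)

CharacteristicZero : HeytingField c ℓ₁ ℓ₂ → Set ℓ₁
CharacteristicZero K = ∀ n → ¬ (suc n · 1# ≈ 0#)
  where
  open CommutativeRing (HeytingField⇒CommutativeRing K)
    using (_≈_; 0#; 1#; +-rawMonoid)
  open import Algebra.Definitions.RawMonoid +-rawMonoid
    using () renaming (_×_ to _·_)

module _ {R : CommutativeRing c ℓ} where

  record Submodule (M : Module R m ℓm) p : Set (c ⊔ m ⊔ ℓm ⊔ lsuc p) where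
    open Module M
    field
      Member   : Pred Carrierᴹ p
      resp     : ∀ {x y} → x ≈ᴹ y → Member x → Member y
      0-closed : Member 0ᴹ
      +-closed : ∀ {x y} → Member x → Member y → Member (x +ᴹ y)
      *-closed : ∀ k {x} → Member x → Member (k *ₗ x)

  module _ (M : Module R m ℓm) where

    open Module M

    data Span (G : Pred Carrierᴹ p) : Pred Carrierᴹ (c ⊔ m ⊔ ℓm ⊔ p) where
      span-gen  : ∀ {x} → G x → Span G x
      span-zero : Span G 0ᴹ
      span-add  : ∀ {x y} → Span G x → Span G y → Span G (x +ᴹ y)
      span-mul  : ∀ k {x} → Span G x → Span G (k *ₗ x)
      span-resp : ∀ {x y} → x ≈ᴹ y → Span G x → Span G y

    span : Pred Carrierᴹ p → Submodule M (c ⊔ m ⊔ ℓm ⊔ p)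
    span G = record
      { Member   = Span G
      ; resp     = span-resp
      ; 0-closed = span-zero
      ; +-closed = span-add
      ; *-closed = span-mul
      }

  -- The quotient M/N has the vectors of M, identified when their
  -- difference lies in N.
  module _ (M : Module R m ℓm) (N : Submodule M p) where

    private module R = CommutativeRing R
    open Module M
    open Submodule N
    open import Algebra.Module.Properties.LeftModule leftModule
      using (inverseʳ-uniqueᴹ; -ᴹ-involutive)
    open import Algebra.Properties.AbelianGroup +ᴹ-abelianGroup
      using (⁻¹-∙-comm; ⁻¹-anti-homo-∙; ε⁻¹≈ε)
    open import Algebra.Properties.CommutativeSemigroup
      (CommutativeMonoid.commutativeSemigroup +ᴹ-commutativeMonoid)
      using (interchange)
    open SetoidReasoning ≈ᴹ-setoid

    infix 4 _≈ᵠ_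
    _≈ᵠ_ : Carrierᴹ → Carrierᴹ → Set p
    x ≈ᵠ y = Member (x +ᴹ -ᴹ y)

    -‿*ₗ : ∀ k x → k *ₗ (-ᴹ x) ≈ᴹ -ᴹ (k *ₗ x)
    -‿*ₗ k x = inverseʳ-uniqueᴹ (k *ₗ x) (k *ₗ (-ᴹ x)) (begin
      k *ₗ x +ᴹ k *ₗ (-ᴹ x)  ≈⟨ *ₗ-distribˡ k x (-ᴹ x) ⟨
      k *ₗ (x +ᴹ -ᴹ x)       ≈⟨ *ₗ-congˡ (-ᴹ‿inverseʳ x) ⟩
      k *ₗ 0ᴹ                ≈⟨ *ₗ-zeroʳ k ⟩
      0ᴹ                     ∎)

    -1*ₗ : ∀ x → (R.- R.1#) *ₗ x ≈ᴹ -ᴹ x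
    -1*ₗ x = inverseʳ-uniqueᴹ x ((R.- R.1#) *ₗ x) (begin
      x +ᴹ (R.- R.1#) *ₗ x           ≈⟨ +ᴹ-congʳ (*ₗ-identityˡ x) ⟨
      R.1# *ₗ x +ᴹ (R.- R.1#) *ₗ x    ≈⟨ *ₗ-distribʳ x R.1# (R.- R.1#) ⟨
      (R.1# R.+ (R.- R.1#)) *ₗ x      ≈⟨ *ₗ-congʳ (R.-‿inverseʳ R.1#) ⟩
      R.0# *ₗ x                    ≈⟨ *ₗ-zeroˡ x ⟩
      0ᴹ                           ∎)

    neg-closed : ∀ {x} → Member x → Member (-ᴹ x)
    neg-closed {x} x∈N = resp (-1*ₗ x) (*-closed (R.- R.1#) x∈N)

    ≈⇒≈ᵠ : ∀ {x y} → x ≈ᴹ y → x ≈ᵠ y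
    ≈⇒≈ᵠ {x} {y} x≈y = resp (≈ᴹ-sym (≈ᴹ-trans (+ᴹ-congʳ x≈y) (-ᴹ‿inverseʳ y))) 0-closed

    symᵠ : ∀ {x y} → x ≈ᵠ y → y ≈ᵠ x
    symᵠ {x} {y} x≈y = resp
      (begin
        -ᴹ (x +ᴹ -ᴹ y)       ≈⟨ ⁻¹-∙-comm x (-ᴹ y) ⟨
        -ᴹ x +ᴹ -ᴹ (-ᴹ y)    ≈⟨ +ᴹ-congˡ (-ᴹ-involutive y) ⟩
        -ᴹ x +ᴹ y            ≈⟨ +ᴹ-comm (-ᴹ x) y ⟩
        y +ᴹ -ᴹ x            ∎)
      (neg-closed x≈y)

    transᵠ : ∀ {x y z} → x ≈ᵠ y → y ≈ᵠ z → x ≈ᵠ z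
    transᵠ {x} {y} {z} x≈y y≈z = resp
      (begin
        (x +ᴹ -ᴹ y) +ᴹ (y +ᴹ -ᴹ z)  ≈⟨ +ᴹ-assoc x (-ᴹ y) _ ⟩
        x +ᴹ (-ᴹ y +ᴹ (y +ᴹ -ᴹ z))  ≈⟨ +ᴹ-congˡ (+ᴹ-assoc (-ᴹ y) y (-ᴹ z)) ⟨
        x +ᴹ ((-ᴹ y +ᴹ y) +ᴹ -ᴹ z)  ≈⟨ +ᴹ-congˡ (+ᴹ-congʳ (-ᴹ‿inverseˡ y)) ⟩
        x +ᴹ (0ᴹ +ᴹ -ᴹ z)           ≈⟨ +ᴹ-congˡ (+ᴹ-identityˡ (-ᴹ z)) ⟩
        x +ᴹ -ᴹ z                   ∎)
      (+-closed x≈y y≈z)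

    +-congᵠ : ∀ {x y u v} → x ≈ᵠ y → u ≈ᵠ v → (x +ᴹ u) ≈ᵠ (y +ᴹ v)
    +-congᵠ {x} {y} {u} {v} x≈y u≈v = resp
      (begin
        (x +ᴹ -ᴹ y) +ᴹ (u +ᴹ -ᴹ v)  ≈⟨ interchange x (-ᴹ y) u (-ᴹ v) ⟩
        (x +ᴹ u) +ᴹ (-ᴹ y +ᴹ -ᴹ v)  ≈⟨ +ᴹ-congˡ (⁻¹-∙-comm y v) ⟩
        (x +ᴹ u) +ᴹ -ᴹ (y +ᴹ v)     ∎)
      (+-closed x≈y u≈v)

    *-congᵠ : ∀ k {x y} → x ≈ᵠ y → (k *ₗ x) ≈ᵠ (k *ₗ y)
    *-congᵠ k {x} {y} x≈y = resp
      (≈ᴹ-trans (*ₗ-distribˡ k x (-ᴹ y)) (+ᴹ-congˡ (-‿*ₗ k y)))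
      (*-closed k x≈y)

    -‿congᵠ : ∀ {x y} → x ≈ᵠ y → (-ᴹ x) ≈ᵠ (-ᴹ y)
    -‿congᵠ {x} {y} x≈y =
      resp (≈ᴹ-sym (⁻¹-∙-comm x (-ᴹ y))) (neg-closed x≈y)

    quotient : Module R m p
    quotient = record
      { Carrierᴹ = Carrierᴹ
      ; _≈ᴹ_     = _≈ᵠ_
      ; _+ᴹ_     = _+ᴹ_
      ; _*ₗ_     = _*ₗ_
      ; _*ᵣ_     = flip _*ₗ_
      ; 0ᴹ       = 0ᴹ
      ; -ᴹ_      = -ᴹ_
      ; isModule = IsModuleFromLeft.isModule {commutativeRing = R} (record
        { isLeftModule = record
          { isLeftSemimodule = record
            { +ᴹ-isCommutativeMonoid = record
              { isMonoid = record
                { isSemigroup = record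
                  { isMagma = record
                    { isEquivalence = record
                      { refl  = ≈⇒≈ᵠ ≈ᴹ-refl
                      ; sym   = symᵠ
                      ; trans = transᵠ
                      }
                    ; ∙-cong = +-congᵠ
                    }
                  ; assoc = λ x y z → ≈⇒≈ᵠ (+ᴹ-assoc x y z)
                  }
                ; identity = (λ x → ≈⇒≈ᵠ (+ᴹ-identityˡ x)) , (λ x → ≈⇒≈ᵠ (+ᴹ-identityʳ x))
                }
              ; comm = λ x y → ≈⇒≈ᵠ (+ᴹ-comm x y)
              }
            ; isPreleftSemimodule = record
              { *ₗ-cong      = λ {k} {l} {x} k≈l x≈y →
                  transᵠ (*-congᵠ k x≈y) (≈⇒≈ᵠ (*ₗ-congʳ k≈l))
              ; *ₗ-zeroˡ     = λ x → ≈⇒≈ᵠ (*ₗ-zeroˡ x)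
              ; *ₗ-distribʳ  = λ x k l → ≈⇒≈ᵠ (*ₗ-distribʳ x k l)
              ; *ₗ-identityˡ = λ x → ≈⇒≈ᵠ (*ₗ-identityˡ x)
              ; *ₗ-assoc     = λ k l x → ≈⇒≈ᵠ (*ₗ-assoc k l x)
              ; *ₗ-zeroʳ     = λ k → ≈⇒≈ᵠ (*ₗ-zeroʳ k)
              ; *ₗ-distribˡ  = λ k x y → ≈⇒≈ᵠ (*ₗ-distribˡ k x y)
              }
            }
          ; -ᴹ‿cong    = -‿congᵠ
          ; -ᴹ‿inverse = (λ x → ≈⇒≈ᵠ (-ᴹ‿inverseˡ x)) , (λ x → ≈⇒≈ᵠ (-ᴹ‿inverseʳ x))
          }
        })
      }

-- Free R B: finite formal sums, equal when all their coefficients are.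
module _ (R : CommutativeRing c ℓ) where

  open CommutativeRing R renaming (Carrier to K; refl to ≈-refl; sym to ≈-sym; trans to ≈-trans)
    hiding (zero)

  module _ (B : DecSetoid b ℓb) where

    open DecSetoid B using (_≟_) renaming (Carrier to I)

    coeff : List (K × I) → I → K
    coeff []            i = 0#
    coeff ((k , j) ∷ x) i = (if does (j ≟ i) then k else 0#) + coeff x i

    scale : K → List (K × I) → List (K × I)
    scale k = map (λ (l , i) → (k * l , i))

    negate : List (K × I) → List (K × I)
    negate = map (λ (l , i) → (- l , i))

    open import Algebra.Properties.Ring ring using (-0#≈0#; -‿+-comm)
    open SetoidReasoning setoid

    coeff-++ : ∀ x y i → coeff (x ++ y) i ≈ coeff x i + coeff y i
    coeff-++ []            y i = ≈-sym (+-identityˡ _)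
    coeff-++ ((k , j) ∷ x) y i =
      ≈-trans (+-congˡ (coeff-++ x y i)) (≈-sym (+-assoc _ _ _))

    coeff-scale : ∀ k x i → coeff (scale k x) i ≈ k * coeff x i
    coeff-scale k []            i = ≈-sym (zeroʳ k)
    coeff-scale k ((l , j) ∷ x) i with does (j ≟ i)
    ... | true  = ≈-trans (+-congˡ (coeff-scale k x i)) (≈-sym (distribˡ k l _))
    ... | false = ≈-trans (+-cong (≈-sym (zeroʳ k)) (coeff-scale k x i)) (≈-sym (distribˡ k 0# _))

    coeff-negate : ∀ x i → coeff (negate x) i ≈ - coeff x i
    coeff-negate []            i = ≈-sym -0#≈0#
    coeff-negate ((l , j) ∷ x) i with does (j ≟ i)
    ... | true  = ≈-trans (+-congˡ (coeff-negate x i)) (-‿+-comm l _)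
    ... | false = ≈-trans (+-cong (≈-sym -0#≈0#) (coeff-negate x i)) (-‿+-comm 0# _)

    Free : Module R (c ⊔ b) (ℓ ⊔ b)
    Free = record
      { Carrierᴹ = List (K × I)
      ; _≈ᴹ_     = λ x y → ∀ i → coeff x i ≈ coeff y i
      ; _+ᴹ_     = _++_
      ; _*ₗ_     = scale
      ; _*ᵣ_     = flip scale
      ; 0ᴹ       = []
      ; -ᴹ_      = negate
      ; isModule = IsModuleFromLeft.isModule {commutativeRing = R} (record
        { isLeftModule = record
          { isLeftSemimodule = record
            { +ᴹ-isCommutativeMonoid = record
              { isMonoid = record
                { isSemigroup = record
                  { isMagma = record
                    { isEquivalence = record
                      { refl  = λ i → ≈-refl
                      ; sym   = λ x≈y i → ≈-sym (x≈y i)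
                      ; trans = λ x≈y y≈z i → ≈-trans (x≈y i) (y≈z i)
                      }
                    ; ∙-cong = λ {x} {y} {u} {v} x≈y u≈v i → begin
                        coeff (x ++ u) i       ≈⟨ coeff-++ x u i ⟩
                        coeff x i + coeff u i  ≈⟨ +-cong (x≈y i) (u≈v i) ⟩
                        coeff y i + coeff v i  ≈⟨ coeff-++ y v i ⟨
                        coeff (y ++ v) i       ∎
                    }
                  ; assoc = λ x y z i → begin
                      coeff ((x ++ y) ++ z) i              ≈⟨ coeff-++ (x ++ y) z i ⟩
                      coeff (x ++ y) i + coeff z i         ≈⟨ +-congʳ (coeff-++ x y i) ⟩
                      (coeff x i + coeff y i) + coeff z i  ≈⟨ +-assoc _ _ _ ⟩
                      coeff x i + (coeff y i + coeff z i)  ≈⟨ +-congˡ (coeff-++ y z i) ⟨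
                      coeff x i + coeff (y ++ z) i         ≈⟨ coeff-++ x (y ++ z) i ⟨
                      coeff (x ++ (y ++ z)) i              ∎
                  }
                ; identity = (λ x i → ≈-refl)
                           , (λ x i → ≈-trans (coeff-++ x [] i) (+-identityʳ _))
                }
              ; comm = λ x y i → begin
                  coeff (x ++ y) i       ≈⟨ coeff-++ x y i ⟩
                  coeff x i + coeff y i  ≈⟨ +-comm _ _ ⟩
                  coeff y i + coeff x i  ≈⟨ coeff-++ y x i ⟨
                  coeff (y ++ x) i       ∎
              }
            ; isPreleftSemimodule = record
              { *ₗ-cong      = λ {k} {l} {x} {y} k≈l x≈y i → begin
                  coeff (scale k x) i  ≈⟨ coeff-scale k x i ⟩
                  k * coeff x i        ≈⟨ *-cong k≈l (x≈y i) ⟩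
                  l * coeff y i        ≈⟨ coeff-scale l y i ⟨
                  coeff (scale l y) i  ∎
              ; *ₗ-zeroˡ     = λ x i → ≈-trans (coeff-scale 0# x i) (zeroˡ _)
              ; *ₗ-distribʳ  = λ x k l i → begin
                  coeff (scale (k + l) x) i                  ≈⟨ coeff-scale (k + l) x i ⟩
                  (k + l) * coeff x i                        ≈⟨ distribʳ _ k l ⟩
                  k * coeff x i + l * coeff x i              ≈⟨ +-cong (coeff-scale k x i) (coeff-scale l x i) ⟨
                  coeff (scale k x) i + coeff (scale l x) i  ≈⟨ coeff-++ (scale k x) (scale l x) i ⟨
                  coeff (scale k x ++ scale l x) i           ∎
              ; *ₗ-identityˡ = λ x i → ≈-trans (coeff-scale 1# x i) (*-identityˡ _)
              ; *ₗ-assoc     = λ k l x i → begin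
                  coeff (scale (k * l) x) i      ≈⟨ coeff-scale (k * l) x i ⟩
                  (k * l) * coeff x i            ≈⟨ *-assoc k l _ ⟩
                  k * (l * coeff x i)            ≈⟨ *-congˡ (coeff-scale l x i) ⟨
                  k * coeff (scale l x) i        ≈⟨ coeff-scale k (scale l x) i ⟨
                  coeff (scale k (scale l x)) i  ∎
              ; *ₗ-zeroʳ     = λ k i → ≈-refl
              ; *ₗ-distribˡ  = λ k x y i → begin
                  coeff (scale k (x ++ y)) i                 ≈⟨ coeff-scale k (x ++ y) i ⟩
                  k * coeff (x ++ y) i                       ≈⟨ *-congˡ (coeff-++ x y i) ⟩
                  k * (coeff x i + coeff y i)                ≈⟨ distribˡ k _ _ ⟩
                  k * coeff x i + k * coeff y i              ≈⟨ +-cong (coeff-scale k x i) (coeff-scale k y i) ⟨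
                  coeff (scale k x) i + coeff (scale k y) i  ≈⟨ coeff-++ (scale k x) (scale k y) i ⟨
                  coeff (scale k x ++ scale k y) i           ∎
              }
            }
          ; -ᴹ‿cong    = λ {x} {y} x≈y i → begin
              coeff (negate x) i  ≈⟨ coeff-negate x i ⟩
              - coeff x i         ≈⟨ -‿cong (x≈y i) ⟩
              - coeff y i         ≈⟨ coeff-negate y i ⟨
              coeff (negate y) i  ∎
          ; -ᴹ‿inverse =
              (λ x i → begin
                coeff (negate x ++ x) i         ≈⟨ coeff-++ (negate x) x i ⟩
                coeff (negate x) i + coeff x i  ≈⟨ +-congʳ (coeff-negate x i) ⟩
                - coeff x i + coeff x i         ≈⟨ -‿inverseˡ _ ⟩
                0#                              ∎)
            , (λ x i → begin
                coeff (x ++ negate x) i         ≈⟨ coeff-++ x (negate x) i ⟩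
                coeff x i + coeff (negate x) i  ≈⟨ +-congˡ (coeff-negate x i) ⟩
                coeff x i + - coeff x i         ≈⟨ -‿inverseʳ _ ⟩
                0#                              ∎)
          }
        })
      }

    basis : I → Module.Carrierᴹ Free
    basis i = [ (1# , i) ]

  bilinear : {A : Set b₁} {B : Set b₂} {C : Set b₃} → (A → B → C) →
             List (K × A) → List (K × B) → List (K × C)
  bilinear f = cartesianProductWith (λ (k , i) (l , j) → (k * l , f i j))

open import Data.Nat.Base using (_+_; _≤_; _<_; z≤n; s≤s; NonZero)

-- The arity k = n + m - 1 of x ∘ᵢ y is a separate index, tied to n and m by
-- an equation, so that no transport between arities is needed.  Input
-- positions are numbered from 0.
record RawOperad (R : CommutativeRing c ℓ) m ℓm : Set (c ⊔ ℓ ⊔ lsuc (m ⊔ ℓm)) where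
  field
    Space : ℕ → Module R m ℓm

  module Space n = Module (Space n)

  field
    comp : ∀ {n m k} → suc k ≡ n + m → Fin n →
           Space.Carrierᴹ n → Space.Carrierᴹ m → Space.Carrierᴹ k
    unit : Space.Carrierᴹ 1

record IsOperad {R : CommutativeRing c ℓ} (O : RawOperad R m ℓm) : Set (c ⊔ m ⊔ ℓm) where
  open RawOperad O
  open module Arity {n} = Module (Space n) using (_≈ᴹ_; _+ᴹ_; _*ₗ_)

  private
    ∣_∣ : ℕ → Set _
    ∣ n ∣ = Space.Carrierᴹ n

  field
    comp-cong : ∀ {n m k} (e : suc k ≡ n + m) i {x x′ : ∣ n ∣} {y y′ : ∣ m ∣} →
                x ≈ᴹ x′ → y ≈ᴹ y′ → comp e i x y ≈ᴹ comp e i x′ y′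

    comp-+ˡ : ∀ {n m k} (e : suc k ≡ n + m) i (x x′ : ∣ n ∣) (y : ∣ m ∣) →
              comp e i (x +ᴹ x′) y ≈ᴹ comp e i x y +ᴹ comp e i x′ y
    comp-+ʳ : ∀ {n m k} (e : suc k ≡ n + m) i (x : ∣ n ∣) (y y′ : ∣ m ∣) →
              comp e i x (y +ᴹ y′) ≈ᴹ comp e i x y +ᴹ comp e i x y′
    comp-*ˡ : ∀ {n m k} (e : suc k ≡ n + m) i a (x : ∣ n ∣) (y : ∣ m ∣) →
              comp e i (a *ₗ x) y ≈ᴹ a *ₗ comp e i x y
    comp-*ʳ : ∀ {n m k} (e : suc k ≡ n + m) i a (x : ∣ n ∣) (y : ∣ m ∣) →
              comp e i x (a *ₗ y) ≈ᴹ a *ₗ comp e i x y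

    -- (x ∘ᵢ y) ∘ᵢ₊ⱼ₋₁ z = x ∘ᵢ (y ∘ⱼ z), where i + j - 1 is the 1-based index
    sequential :
      ∀ {n m p k l r} (x : ∣ n ∣) (y : ∣ m ∣) (z : ∣ p ∣)
      (xy : suc k ≡ n + m) (xy-z : suc r ≡ k + p)
      (yz : suc l ≡ m + p) (x-yz : suc r ≡ n + l)
      (i : Fin n) (j : Fin m) (i+j : Fin k) → toℕ i+j ≡ toℕ i + toℕ j →
      comp xy-z i+j (comp xy i x y) z ≈ᴹ comp x-yz i x (comp yz j y z)

    -- (x ∘ᵢ y) ∘ⱼ₊ₘ₋₁ z = (x ∘ⱼ z) ∘ᵢ y for i < j
    parallel :
      ∀ {n m p k l r} (x : ∣ n ∣) (y : ∣ m ∣) (z : ∣ p ∣)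
      (xy : suc k ≡ n + m) (xy-z : suc r ≡ k + p)
      (xz : suc l ≡ n + p) (xz-y : suc r ≡ l + m)
      (i j : Fin n) → i Fin.< j →
      (j′ : Fin k) → suc (toℕ j′) ≡ toℕ j + m →
      (i′ : Fin l) → toℕ i′ ≡ toℕ i →
      comp xy-z j′ (comp xy i x y) z ≈ᴹ comp xz-y i′ (comp xz j x z) y

    identityˡ : ∀ {n} (e : suc n ≡ 1 + n) (x : ∣ n ∣) → comp e Fin.zero unit x ≈ᴹ x
    identityʳ : ∀ {n} (e : suc n ≡ n + 1) i (x : ∣ n ∣) → comp e i x unit ≈ᴹ x

GradedSubspace : {R : CommutativeRing c ℓ} → RawOperad R m ℓm → ∀ p → Set _
GradedSubspace O p = ∀ n → Submodule (RawOperad.Space O n) p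

-- The quotient spaces with the operations of O on representatives.  That these
-- are well defined on classes is comp-cong in IsOperad (O /ᴼ V).
infixl 7 _/ᴼ_
_/ᴼ_ : {R : CommutativeRing c ℓ} (O : RawOperad R m ℓm) →
       GradedSubspace O p → RawOperad R m p
O /ᴼ V = record
  { Space = λ n → quotient (Space n) (V n)
  ; comp  = comp
  ; unit  = unit
  }
  where open RawOperad O

RangeMap : Set
RangeMap = (i : ℕ) → .{{NonZero i}} → ℕ

Unimodal : RangeMap → Set
Unimodal δ = ∀ i₁ i₂ i₃ .{{_ : NonZero i₁}} .{{_ : NonZero i₂}} .{{_ : NonZero i₃}} →
             i₁ < i₂ → i₂ < i₃ → ¬ (δ i₂ < δ i₁ × δ i₂ < δ i₃)

WeaklyIncreasing : RangeMap → Set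
WeaklyIncreasing ρ = ∀ i j .{{_ : NonZero i}} .{{_ : NonZero j}} → i ≤ j → ρ i ≤ ρ j

-- max {δ(1), …, δ(i)}; the default value 0 is harmless
bar : RangeMap → RangeMap
bar δ i = max 0 (applyUpTo (λ j → δ (suc j)) i)

bar-weaklyIncreasing : ∀ δ → WeaklyIncreasing (bar δ)
bar-weaklyIncreasing δ i j i≤j = max≤v⁺ z≤n
  (All.applyUpTo⁺₁ f i λ k<i →
    v≤max⁺ 0 (applyUpTo f j) (inj₂ (Any.applyUpTo⁺ f ℕ.≤-refl (ℕ.≤-trans k<i i≤j))))
  where
  f : ℕ → ℕ
  f k = δ (suc k)

Word : Set
Word = List ℕ

IsCliff : RangeMap → Word → Set
IsCliff δ w = ∀ (i : Fin (length w)) → lookup w i ≤ δ (suc (toℕ i))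

record Cliff (δ : RangeMap) (n : ℕ) : Set where
  constructor mkCliff
  field
    word    : Word
    size    : suc (length word) ≡ n
    isCliff : IsCliff δ word

open Cliff public

cliffDecSetoid : RangeMap → ℕ → DecSetoid 0ℓ 0ℓ
cliffDecSetoid δ n = On.decSetoid (≡.decSetoid (≡-dec ℕ._≟_)) (word {δ} {n})

-- u □ᵢ v; as positions are numbered from 0, i is the length of the prefix
insert : ℕ → Word → Word → Word
insert i u v = take i u ++ v ++ drop i u

length-insert : ∀ i u v → length (insert i u v) ≡ length u + length v
length-insert zero    u       v = trans (length-++ v) (ℕ.+-comm (length v) (length u))
length-insert (suc i) []      v = trans (length-++ v) (ℕ.+-identityʳ (length v))
length-insert (suc i) (x ∷ u) v = cong suc (length-insert i u v)

module _ {ρ : RangeMap} (ρ↗ : WeaklyIncreasing ρ) where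

  private
    CliffFrom : ℕ → Word → Set
    CliffFrom k w = ∀ (i : Fin (length w)) → lookup w i ≤ ρ (suc (k + toℕ i))

    ρ-mono : ∀ {i j} → i ≤ j → ρ (suc i) ≤ ρ (suc j)
    ρ-mono {i} {j} i≤j = ρ↗ (suc i) (suc j) (s≤s i≤j)

    later : ∀ {k l} w → k ≤ l → CliffFrom k w → CliffFrom l w
    later w k≤l cl i = ℕ.≤-trans (cl i) (ρ-mono (ℕ.+-monoˡ-≤ (toℕ i) k≤l))

    uncons : ∀ {k x} w → CliffFrom k (x ∷ w) → CliffFrom (suc k) w
    uncons {k} w cl i = ℕ.≤-trans (cl (Fin.suc i)) (ρ-mono (ℕ.≤-reflexive (ℕ.+-suc k (toℕ i))))

    cons : ∀ {k x} w → x ≤ ρ (suc (k + 0)) → CliffFrom (suc k) w → CliffFrom k (x ∷ w)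
    cons     w h cl Fin.zero    = h
    cons {k} w h cl (Fin.suc i) =
      ℕ.≤-trans (cl i) (ρ-mono (ℕ.≤-reflexive (sym (ℕ.+-suc k (toℕ i)))))

    append : ∀ {k} u v → CliffFrom k u → CliffFrom k v → CliffFrom k (u ++ v)
    append     []      v cu cv = cv
    append {k} (x ∷ u) v cu cv =
      cons (u ++ v) (cu Fin.zero) (append u v (uncons u cu) (later v (ℕ.n≤1+n k) cv))

    insertFrom : ∀ {k} i u v → CliffFrom k u → CliffFrom k v → CliffFrom k (insert i u v)
    insertFrom     zero    u       v cu cv = append v u cv cu
    insertFrom     (suc i) []      v cu cv = append v [] cv cu
    insertFrom {k} (suc i) (x ∷ u) v cu cv =
      cons (insert i u v) (cu Fin.zero)
        (insertFrom i u v (uncons u cu) (later v (ℕ.n≤1+n k) cv))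

  insert-isCliff : ∀ i u v → IsCliff ρ u → IsCliff ρ v → IsCliff ρ (insert i u v)
  insert-isCliff = insertFrom

  insertCliff : ∀ {n m k} → suc k ≡ n + m → Fin n → Cliff ρ n → Cliff ρ m → Cliff ρ k
  insertCliff {n} {m} {k} e i (mkCliff u su cu) (mkCliff v sv cv) = record
    { word    = insert (toℕ i) u v
    ; size    = ℕ.suc-injective (begin
        suc (suc (length (insert (toℕ i) u v)))  ≡⟨ cong (λ l → suc (suc l)) (length-insert (toℕ i) u v) ⟩
        suc (suc (length u + length v))          ≡⟨ cong suc (ℕ.+-suc (length u) (length v)) ⟨
        suc (length u) + suc (length v)          ≡⟨ cong₂ _+_ su sv ⟩
        n + m                                    ≡⟨ e ⟨
        suc k                                    ∎)
    ; isCliff = insert-isCliff (toℕ i) u v cu cv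
    }
    where open ≡-Reasoning

ε : ∀ {δ} → Cliff δ 1
ε = mkCliff [] refl λ ()

module _ (R : CommutativeRing c ℓ) where

  Cl : (ρ : RangeMap) → WeaklyIncreasing ρ → RawOperad R c ℓ
  Cl ρ ρ↗ = record
    { Space = λ n → Free R (cliffDecSetoid ρ n)
    ; comp  = λ e i → bilinear R (insertCliff ρ↗ e i)
    ; unit  = basis R (cliffDecSetoid ρ 1) ε
    }

  V : (δ : RangeMap) → GradedSubspace (Cl (bar δ) (bar-weaklyIncreasing δ)) (c ⊔ ℓ)
  V δ n = span (Free R B) λ x → Σ[ w ∈ Cliff (bar δ) n ] ¬ IsCliff δ (word w) × x ≡ basis R B w
    where B = cliffDecSetoid (bar δ) n

{-# OPTIONS --safe #-}

-- 𝒱_δ is an operadic ideal of Cl_δ̄, so the quotient inherits the operad axioms.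
-- Both u and v are subwords of u □ᵢ v, and passing to a larger word can only
-- move a letter to the right.  If w ∈ Cl_δ̄ has a letter a = w(p) > δ(p), then
-- some q < p has δ(q) ≥ a > δ(p), so by unimodality δ(r) ≤ δ(p) < a for all
-- r > p: wherever a is moved to, it still violates the bound.

module Submission where

open import Defs
open import Algebra.Apartness.Bundles using (HeytingField)
open import Algebra.Bundles using (CommutativeRing; CommutativeMonoid)
open import Algebra.Module.Bundles using (Module)
open import Data.Bool.Base using (true; false; if_then_else_)
open import Data.Bool.Properties using (if-cong)
open import Data.Fin.Base as Fin using (Fin; toℕ)
open import Data.Fin.Properties using (toℕ<n)
open import Data.List.Base using (List; []; _∷_; _++_; map; length; lookup; take; drop)
open import Data.List.Extrema.Nat using (max≤v⁺)
open import Data.List.Properties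
  using (++-assoc; ++-identityʳ; take++drop≡id; cartesianProductWith-distribʳ-++)
open import Data.List.Relation.Binary.Sublist.Propositional
  using (_⊆_; []; _∷_; _∷ʳ_; ⊆-refl; ⊆-reflexive; ⊆-trans)
open import Data.List.Relation.Binary.Sublist.Propositional.Properties using (++⁺; ++⁺ˡ; ++⁺ʳ)
import Data.List.Relation.Unary.All.Properties as All
open import Data.Nat.Base using (ℕ; zero; suc)
import Data.Nat.Properties as ℕ
open import Data.Product.Base using (_×_; _,_; Σ-syntax)
open import Data.Sum.Base using (inj₁; inj₂)
open import Function.Base using (_∘_)
open import Function.Bundles using (mk⇔)
open import Level using (Level; _⊔_)
open import Relation.Binary.Bundles using (DecSetoid)
open import Relation.Binary.PropositionalEquality as ≡ using (_≡_; refl; cong; subst)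
import Relation.Binary.Reasoning.Setoid as SetoidReasoning
open import Relation.Unary using (Pred)
open import Relation.Nullary using (¬_; does; yes; no; contradiction)
open import Relation.Nullary.Decidable using (dec-true; dec-false; does-⇔)

private
  variable
    a b c d ℓ ℓa ℓb ℓd m ℓm p : Level

-- Linear functionals on formal sums

module _ (R : CommutativeRing c ℓ) where

  open CommutativeRing R renaming (Carrier to K; refl to ≈-refl) hiding (zero)
  open import Algebra.Properties.Ring ring
    using (-0#≈0#; -‿+-comm; -‿distribˡ-*)
  open import Algebra.Properties.Group +-group using (x∙y⁻¹≈ε⇒x≈y)
  open import Algebra.Properties.CommutativeSemigroup
    (CommutativeMonoid.commutativeSemigroup +-commutativeMonoid)
    using (interchange; x∙yz≈y∙xz)
  open import Algebra.Properties.CommutativeSemigroup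
    (CommutativeMonoid.commutativeSemigroup *-commutativeMonoid)
    using () renaming (x∙yz≈y∙xz to *-swapˡ)
  open SetoidReasoning setoid

  module _ {A : Set a} where

    -- The linear functional with value `φ i` on the basis vector `i`. It is evaluated on the list
    -- itself, so the linearity laws below need no equality on `A`.
    extend : (A → K) → List (K × A) → K
    extend φ []            = 0#
    extend φ ((k , i) ∷ x) = k * φ i + extend φ x

    extend-cong : ∀ {φ ψ} → (∀ i → φ i ≈ ψ i) → ∀ x → extend φ x ≈ extend ψ x
    extend-cong φ≈ψ []            = ≈-refl
    extend-cong φ≈ψ ((k , i) ∷ x) = +-cong (*-congˡ (φ≈ψ i)) (extend-cong φ≈ψ x)

    extend-++ : ∀ φ x y → extend φ (x ++ y) ≈ extend φ x + extend φ y
    extend-++ φ []            y = sym (+-identityˡ _)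
    extend-++ φ ((k , i) ∷ x) y = trans (+-congˡ (extend-++ φ x y)) (sym (+-assoc _ _ _))

    extend-scale : ∀ φ k x → extend φ (map (λ (l , i) → (k * l , i)) x) ≈ k * extend φ x
    extend-scale φ k []            = sym (zeroʳ k)
    extend-scale φ k ((l , i) ∷ x) =
      trans (+-cong (*-assoc k l _) (extend-scale φ k x)) (sym (distribˡ k _ _))

    extend-negate : ∀ φ x → extend φ (map (λ (l , i) → (- l , i)) x) ≈ - extend φ x
    extend-negate φ []            = sym -0#≈0#
    extend-negate φ ((l , i) ∷ x) =
      trans (+-cong (sym (-‿distribˡ-* l _)) (extend-negate φ x)) (-‿+-comm _ _)

    extend-0 : ∀ x → extend (λ _ → 0#) x ≈ 0#
    extend-0 []            = ≈-refl
    extend-0 ((k , i) ∷ x) = trans (+-cong (zeroʳ k) (extend-0 x)) (+-identityˡ 0#)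

    extend-+ : ∀ φ ψ x → extend (λ i → φ i + ψ i) x ≈ extend φ x + extend ψ x
    extend-+ φ ψ []            = sym (+-identityˡ 0#)
    extend-+ φ ψ ((k , i) ∷ x) =
      trans (+-cong (distribˡ k _ _) (extend-+ φ ψ x)) (interchange _ _ _ _)

    extend-* : ∀ k φ x → extend (λ i → k * φ i) x ≈ k * extend φ x
    extend-* k φ []            = sym (zeroʳ k)
    extend-* k φ ((l , i) ∷ x) =
      trans (+-cong (*-swapˡ l k _) (extend-* k φ x)) (sym (distribˡ k _ _))

  -- Interchange of two finite sums. It is what the parallel axiom needs, where the two inserted
  -- elements enter in opposite orders.
  extend-swap : {A : Set a} {B : Set b} (h : A → B → K) → ∀ x y →
                extend (λ i → extend (h i) y) x ≈ extend (λ j → extend (λ i → h i j) x) y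
  extend-swap h []            y = sym (extend-0 y)
  extend-swap h ((k , i) ∷ x) y = begin
    k * extend (h i) y + extend (λ i → extend (h i) y) x
      ≈⟨ +-cong (sym (extend-* k (h i) y)) (extend-swap h x y) ⟩
    extend (λ j → k * h i j) y + extend (λ j → extend (λ i → h i j) x) y
      ≈⟨ extend-+ _ _ y ⟨
    extend (λ j → k * h i j + extend (λ i → h i j) x) y
      ∎

  -- Evaluating a product becomes an iterated sum over its factors, which reduces multilinear
  -- identities to identities between basis elements.
  extend-bilinear : {A : Set a} {B : Set b} {C : Set d} (f : A → B → C) → ∀ φ x y →
                    extend φ (bilinear R f x y) ≈ extend (λ i → extend (λ j → φ (f i j)) y) x
  extend-bilinear f φ []            y = ≈-refl
  extend-bilinear f φ ((k , i) ∷ x) y =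
    trans (extend-++ φ (map _ y) _) (+-cong (row y) (extend-bilinear f φ x y))
    where
    row : ∀ y → extend φ (map (λ (l , j) → (k * l , f i j)) y) ≈ k * extend (λ j → φ (f i j)) y
    row []            = sym (zeroʳ k)
    row ((l , j) ∷ y) = trans (+-cong (*-assoc k l _) (row y)) (sym (distribˡ k _ _))

  -- Equality of formal sums tested by functionals

  module _ (B : DecSetoid b ℓm) where

    open DecSetoid B using (_≟_) renaming (Carrier to I; _≈_ to _∼_)
    private module B = DecSetoid B

    open Module (Free R B) using (_≈ᴹ_; _+ᴹ_; -ᴹ_)

    Respects : (I → K) → Set _
    Respects φ = ∀ {i j} → i ∼ j → φ i ≈ φ j

    indicator : I → I → K
    indicator i j = if does (j ≟ i) then 1# else 0#

    indicator-respects : ∀ i → Respects (indicator i)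
    indicator-respects i {j} {j′} j∼j′ = reflexive (if-cong
      (does-⇔ (mk⇔ (B.trans (B.sym j∼j′)) (B.trans j∼j′)) (j ≟ i) (j′ ≟ i)))

    coeff-extend : ∀ x i → coeff R B x i ≈ extend (indicator i) x
    coeff-extend []            i = ≈-refl
    coeff-extend ((k , j) ∷ x) i with does (j ≟ i)
    ... | true  = +-cong (sym (*-identityʳ k)) (coeff-extend x i)
    ... | false = +-cong (sym (zeroʳ k)) (coeff-extend x i)

    -- Taking a coefficient is itself a functional, the extension of `indicator i`, so functionals
    -- separate formal sums.
    ≈ᴹ-byExtend : ∀ x y → (∀ φ → Respects φ → extend φ x ≈ extend φ y) → x ≈ᴹ y
    ≈ᴹ-byExtend x y h i = begin
      coeff R B x i           ≈⟨ coeff-extend x i ⟩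
      extend (indicator i) x  ≈⟨ h (indicator i) (indicator-respects i) ⟩
      extend (indicator i) y  ≈⟨ coeff-extend y i ⟨
      coeff R B y i           ∎

    private
      erase : I → (I → K) → I → K
      erase i φ j = if does (j ≟ i) then 0# else φ j

      erase-respects : ∀ i {φ} → Respects φ → Respects (erase i φ)
      erase-respects i {φ} resp {j} {j′} j∼j′ with j ≟ i | j′ ≟ i
      ... | yes _   | yes _    = ≈-refl
      ... | yes j∼i | no j′≁i  = contradiction (B.trans (B.sym j∼j′) j∼i) j′≁i
      ... | no j≁i  | yes j′∼i = contradiction (B.trans j∼j′ j′∼i) j≁i
      ... | no _    | no _     = resp j∼j′

      -- All terms of `x` whose index is equal to `i` are collected into one, with total coefficient
      -- `coeff R B x i`; `erase i φ` evaluates the remaining ones.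
      extend-erase : ∀ i {φ} → Respects φ → ∀ x →
                     extend φ x ≈ coeff R B x i * φ i + extend (erase i φ) x
      extend-erase i {φ} resp [] = sym (trans (+-identityʳ _) (zeroˡ _))
      extend-erase i {φ} resp ((k , j) ∷ x) with j ≟ i
      ... | yes j∼i = begin
        k * φ j + extend φ x
          ≈⟨ +-cong (*-congˡ (resp j∼i)) (extend-erase i resp x) ⟩
        k * φ i + (coeff R B x i * φ i + extend (erase i φ) x)
          ≈⟨ +-assoc _ _ _ ⟨
        (k * φ i + coeff R B x i * φ i) + extend (erase i φ) x
          ≈⟨ +-cong (sym (distribʳ _ _ _)) (sym (trans (+-congʳ (zeroʳ k)) (+-identityˡ _))) ⟩
        (k + coeff R B x i) * φ i + (k * 0# + extend (erase i φ) x)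
          ∎
      ... | no _ = begin
        k * φ j + extend φ x
          ≈⟨ +-congˡ (extend-erase i resp x) ⟩
        k * φ j + (coeff R B x i * φ i + extend (erase i φ) x)
          ≈⟨ x∙yz≈y∙xz _ _ _ ⟩
        coeff R B x i * φ i + (k * φ j + extend (erase i φ) x)
          ≈⟨ +-congʳ (*-congʳ (+-identityˡ _)) ⟨
        (0# + coeff R B x i) * φ i + (k * φ j + extend (erase i φ) x)
          ∎

    -- Allowing φ to vanish where x does not makes structural induction on x work:
    -- a head term at i is removed by erasing φ at i.
    extend-vanishes : ∀ {φ} → Respects φ → ∀ x →
                      (∀ i → coeff R B x i * φ i ≈ 0#) → extend φ x ≈ 0#
    extend-vanishes         resp []                  xφ≈0 = ≈-refl
    extend-vanishes {φ = φ} resp x@((k , i) ∷ x′) xφ≈0 = begin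
      extend φ x                                    ≈⟨ extend-erase i resp x ⟩
      coeff R B x i * φ i + extend (erase i φ) x    ≈⟨ +-congʳ (xφ≈0 i) ⟩
      0# + (k * erase i φ i + extend (erase i φ) x′)
        ≈⟨ +-identityˡ _ ⟩
      k * erase i φ i + extend (erase i φ) x′
        ≈⟨ +-cong (*-congˡ (reflexive (if-cong (dec-true (i ≟ i) B.refl))))
                  (extend-vanishes (erase-respects i resp) x′ x′φ≈0) ⟩
      k * 0# + 0#                                   ≈⟨ trans (+-identityʳ _) (zeroʳ k) ⟩
      0#                                            ∎
      where
      x′φ≈0 : ∀ j → coeff R B x′ j * erase i φ j ≈ 0#
      x′φ≈0 j with j ≟ i
      ... | yes _  = zeroʳ _
      ... | no j≁i = trans (*-congʳ (sym (trans
        (+-congʳ (reflexive (if-cong (dec-false (i ≟ j) (j≁i ∘ B.sym)))))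
        (+-identityˡ _)))) (xφ≈0 j)

    -- The converse of `≈ᴹ-byExtend`: the difference of `x` and `y` has only zero coefficients, so
    -- `extend-vanishes` applies to it. `Respects φ` enters because coefficients merge terms with
    -- equal indices.
    extend-resp : ∀ {φ} → Respects φ → ∀ x y → x ≈ᴹ y → extend φ x ≈ extend φ y
    extend-resp {φ} resp x y x≈y = x∙y⁻¹≈ε⇒x≈y _ _ (begin
      extend φ x + - extend φ y            ≈⟨ +-congˡ (extend-negate φ y) ⟨
      extend φ x + extend φ (-ᴹ y)         ≈⟨ extend-++ φ x (-ᴹ y) ⟨
      extend φ (x +ᴹ -ᴹ y)                 ≈⟨ extend-vanishes resp (x +ᴹ -ᴹ y) (λ i →
        trans (*-congʳ (difference i)) (zeroˡ _)) ⟩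
      0#                                   ∎)
      where
      difference : ∀ i → coeff R B (x +ᴹ -ᴹ y) i ≈ 0#
      difference i = begin
        coeff R B (x +ᴹ -ᴹ y) i            ≈⟨ coeff-++ R B x (-ᴹ y) i ⟩
        coeff R B x i + coeff R B (-ᴹ y) i ≈⟨ +-cong (x≈y i) (coeff-negate R B y i) ⟩
        coeff R B y i + - coeff R B y i    ≈⟨ -‿inverseʳ _ ⟩
        0#                                 ∎

  -- Bilinear extension of a map between bases

  module _ {A : DecSetoid a ℓa} {B : DecSetoid b ℓb} {D : DecSetoid d ℓd}
           (f : DecSetoid.Carrier A → DecSetoid.Carrier B → DecSetoid.Carrier D) where

    private
      module A = DecSetoid A
      module B = DecSetoid B
      module D = DecSetoid D
      module FA = Module (Free R A)
      module FB = Module (Free R B)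
      module FD = Module (Free R D)

      infixl 7 _·_
      _·_ : FA.Carrierᴹ → FB.Carrierᴹ → FD.Carrierᴹ
      _·_ = bilinear R f

    -- The arguments change one at a time. With `y` fixed, `x` is evaluated by the functional whose
    -- value at `i` is the inner sum over `y`; it respects equality of indices because `f` and `φ`
    -- do.
    bilinear-cong : (∀ {i i′ j j′} → i A.≈ i′ → j B.≈ j′ → f i j D.≈ f i′ j′) →
                    ∀ {x x′ y y′} → x FA.≈ᴹ x′ → y FB.≈ᴹ y′ → x · y FD.≈ᴹ x′ · y′
    bilinear-cong f-cong {x} {x′} {y} {y′} x≈x′ y≈y′ = ≈ᴹ-byExtend D (x · y) (x′ · y′) λ φ resp → begin
      extend φ (x · y)
        ≈⟨ extend-bilinear f φ x y ⟩
      extend (λ i → extend (λ j → φ (f i j)) y) x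
        ≈⟨ extend-resp A (λ i≈i′ → extend-cong (λ j → resp (f-cong i≈i′ B.refl)) y) x x′ x≈x′ ⟩
      extend (λ i → extend (λ j → φ (f i j)) y) x′
        ≈⟨ extend-cong (λ i → extend-resp B (λ j≈j′ → resp (f-cong A.refl j≈j′)) y y′ y≈y′) x′ ⟩
      extend (λ i → extend (λ j → φ (f i j)) y′) x′
        ≈⟨ extend-bilinear f φ x′ y′ ⟨
      extend φ (x′ · y′)
        ∎

    bilinear-+ˡ : ∀ x x′ y → (x FA.+ᴹ x′) · y FD.≈ᴹ x · y FD.+ᴹ x′ · y
    bilinear-+ˡ x x′ y i =
      reflexive (cong (λ z → coeff R D z i) (cartesianProductWith-distribʳ-++ _ x x′ y))

    -- `bilinear` runs through its left factor first, so additivity on the left is an equality of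
    -- lists, whereas here the terms come in a different order and functionals are used to compare
    -- them.
    bilinear-+ʳ : ∀ x y y′ → x · (y FB.+ᴹ y′) FD.≈ᴹ x · y FD.+ᴹ x · y′
    bilinear-+ʳ x y y′ = ≈ᴹ-byExtend D (x · (y FB.+ᴹ y′)) (x · y FD.+ᴹ x · y′) λ φ resp → begin
      extend φ (x · (y FB.+ᴹ y′))
        ≈⟨ extend-bilinear f φ x _ ⟩
      extend (λ i → extend (λ j → φ (f i j)) (y FB.+ᴹ y′)) x
        ≈⟨ extend-cong (λ i → extend-++ _ y y′) x ⟩
      extend (λ i → extend (λ j → φ (f i j)) y + extend (λ j → φ (f i j)) y′) x
        ≈⟨ extend-+ _ _ x ⟩
      extend (λ i → extend (λ j → φ (f i j)) y) x + extend (λ i → extend (λ j → φ (f i j)) y′) x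
        ≈⟨ +-cong (extend-bilinear f φ x y) (extend-bilinear f φ x y′) ⟨
      extend φ (x · y) + extend φ (x · y′)
        ≈⟨ extend-++ φ (x · y) _ ⟨
      extend φ (x · y FD.+ᴹ x · y′)
        ∎

    bilinear-*ˡ : ∀ k x y → (k FA.*ₗ x) · y FD.≈ᴹ k FD.*ₗ (x · y)
    bilinear-*ˡ k x y = ≈ᴹ-byExtend D ((k FA.*ₗ x) · y) (k FD.*ₗ (x · y)) λ φ resp → begin
      extend φ ((k FA.*ₗ x) · y)
        ≈⟨ extend-bilinear f φ (k FA.*ₗ x) y ⟩
      extend (λ i → extend (λ j → φ (f i j)) y) (k FA.*ₗ x)
        ≈⟨ extend-scale _ k x ⟩
      k * extend (λ i → extend (λ j → φ (f i j)) y) x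
        ≈⟨ *-congˡ (extend-bilinear f φ x y) ⟨
      k * extend φ (x · y)
        ≈⟨ extend-scale φ k (x · y) ⟨
      extend φ (k FD.*ₗ (x · y))
        ∎

    bilinear-*ʳ : ∀ k x y → x · (k FB.*ₗ y) FD.≈ᴹ k FD.*ₗ (x · y)
    bilinear-*ʳ k x y = ≈ᴹ-byExtend D (x · (k FB.*ₗ y)) (k FD.*ₗ (x · y)) λ φ resp → begin
      extend φ (x · (k FB.*ₗ y))
        ≈⟨ extend-bilinear f φ x _ ⟩
      extend (λ i → extend (λ j → φ (f i j)) (k FB.*ₗ y)) x
        ≈⟨ extend-cong (λ i → extend-scale _ k y) x ⟩
      extend (λ i → k * extend (λ j → φ (f i j)) y) x
        ≈⟨ extend-* k _ x ⟩
      k * extend (λ i → extend (λ j → φ (f i j)) y) x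
        ≈⟨ *-congˡ (extend-bilinear f φ x y) ⟨
      k * extend φ (x · y)
        ≈⟨ extend-scale φ k (x · y) ⟨
      extend φ (k FD.*ₗ (x · y))
        ∎

  extend-basis : (B : DecSetoid b ℓb) → ∀ φ i → extend φ (basis R B i) ≈ φ i
  extend-basis B φ i = trans (+-identityʳ _) (*-identityˡ _)

  -- This and `extend-bilinearʳ` unfold the two bracketings into triple sums with the same order of
  -- summation, so that they can be compared term by term.
  extend-bilinearˡ : {A : Set a} {B : Set b} {C : Set d} {D : Set ℓd} {E : Set p}
    (f : A → B → D) (g : D → C → E) → ∀ φ x y z →
    extend φ (bilinear R g (bilinear R f x y) z) ≈
    extend (λ i → extend (λ j → extend (λ k → φ (g (f i j) k)) z) y) x
  extend-bilinearˡ f g φ x y z =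
    trans (extend-bilinear g φ (bilinear R f x y) z) (extend-bilinear f _ x y)

  extend-bilinearʳ : {A : Set a} {B : Set b} {C : Set d} {D : Set ℓd} {E : Set p}
    (f : B → C → D) (g : A → D → E) → ∀ φ x y z →
    extend φ (bilinear R g x (bilinear R f y z)) ≈
    extend (λ i → extend (λ j → extend (λ k → φ (g i (f j k))) z) y) x
  extend-bilinearʳ f g φ x y z =
    trans (extend-bilinear g φ x _) (extend-cong (λ i → extend-bilinear f _ y z) x)

open import Data.Nat.Base using (_+_; _≤_; _<_; z≤n; s≤s; s≤s⁻¹)

-- Insertion of words into words

insert-++ˡ : ∀ {j} v u w → j ≤ length v → insert j (v ++ u) w ≡ insert j v w ++ u
insert-++ˡ {zero}  v       u w _         = ≡.sym (++-assoc w v u)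
insert-++ˡ {suc j} (x ∷ v) u w (s≤s j≤v) = cong (x ∷_) (insert-++ˡ v u w j≤v)

insert-++ʳ : ∀ j v u w → insert (length v + j) (v ++ u) w ≡ v ++ insert j u w
insert-++ʳ j []      u w = refl
insert-++ʳ j (x ∷ v) u w = cong (x ∷_) (insert-++ʳ j v u w)

-- Stripping the first `i` letters of `u` from both sides leaves an insertion into `v ++ u` at a
-- position inside `v` or at its end.
insert-sequential : ∀ {i j} u v w → i ≤ length u → j ≤ length v →
                    insert (i + j) (insert i u v) w ≡ insert i u (insert j v w)
insert-sequential {zero}  u       v w _         j≤v = insert-++ˡ v u w j≤v
insert-sequential {suc i} (x ∷ u) v w (s≤s i≤u) j≤v = cong (x ∷_) (insert-sequential u v w i≤u j≤v)

-- After the common prefix of length `i` is stripped, `v` stands in front, and the insertion of `w`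
-- at `j + length v` steps over the whole block `v`.
insert-parallel : ∀ {i j} u v w → i ≤ j → j ≤ length u →
                  insert (j + length v) (insert i u v) w ≡ insert i (insert j u w) v
insert-parallel {zero} {j} u v w _ _ =
  ≡.trans (cong (λ l → insert l (v ++ u) w) (ℕ.+-comm j (length v))) (insert-++ʳ j v u w)
insert-parallel {suc i} {suc j} (x ∷ u) v w (s≤s i≤j) (s≤s j≤u) = cong (x ∷_) (insert-parallel u v w i≤j j≤u)

-- The arity is the length plus one: inputs correspond to the gaps around the letters, including the
-- one after the last letter.
position≤length : ∀ {ρ n} (u : Cliff ρ n) (i : Fin n) → toℕ i ≤ length (word u)
position≤length u i = s≤s⁻¹ (subst (toℕ i <_) (≡.sym (size u)) (toℕ<n i))

-- The operad of cliffs

module _ (R : CommutativeRing c ℓ) {ρ : RangeMap} (ρ↗ : WeaklyIncreasing ρ) where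

  open CommutativeRing R using (trans; sym)
  open RawOperad (Cl R ρ ρ↗)

  private
    B : ℕ → DecSetoid _ _
    B = cliffDecSetoid ρ

    ∣_∣ : ℕ → Set _
    ∣ n ∣ = Space.Carrierᴹ n

    □ : ∀ {n m k} → suc k ≡ n + m → Fin n → Cliff ρ n → Cliff ρ m → Cliff ρ k
    □ = insertCliff ρ↗

  -- Both sides become triple sums over `x`, `y`, `z`. Cliffs are compared by their words alone, so
  -- equality of the inserted words settles each term.
  Cl-sequential :
    ∀ {n m p k l r} (x : ∣ n ∣) (y : ∣ m ∣) (z : ∣ p ∣)
    (xy : suc k ≡ n + m) (xy-z : suc r ≡ k + p)
    (yz : suc l ≡ m + p) (x-yz : suc r ≡ n + l)
    (i : Fin n) (j : Fin m) (i+j : Fin k) → toℕ i+j ≡ toℕ i + toℕ j →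
    Space._≈ᴹ_ r (comp xy-z i+j (comp xy i x y) z) (comp x-yz i x (comp yz j y z))
  Cl-sequential {r = r} x y z xy xy-z yz x-yz i j i+j i+j≡ =
    ≈ᴹ-byExtend R (B r)
      (comp xy-z i+j (comp xy i x y) z) (comp x-yz i x (comp yz j y z)) λ φ resp →
    trans (extend-bilinearˡ R (□ xy i) (□ xy-z i+j) φ x y z)
    (trans (extend-cong R (λ u → extend-cong R (λ v → extend-cong R (λ w →
        resp {□ xy-z i+j (□ xy i u v) w} {□ x-yz i u (□ yz j v w)} (word-≡ u v w)) z) y) x)
      (sym (extend-bilinearʳ R (□ yz j) (□ x-yz i) φ x y z)))
    where
    word-≡ : ∀ u v w → insert (toℕ i+j) (insert (toℕ i) (word u) (word v)) (word w) ≡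
                       insert (toℕ i) (word u) (insert (toℕ j) (word v) (word w))
    word-≡ u v w = ≡.trans (cong (λ l → insert l _ (word w)) i+j≡)
      (insert-sequential (word u) (word v) (word w) (position≤length u i) (position≤length v j))

  Cl-parallel :
    ∀ {n m p k l r} (x : ∣ n ∣) (y : ∣ m ∣) (z : ∣ p ∣)
    (xy : suc k ≡ n + m) (xy-z : suc r ≡ k + p)
    (xz : suc l ≡ n + p) (xz-y : suc r ≡ l + m)
    (i j : Fin n) → i Fin.< j →
    (j′ : Fin k) → suc (toℕ j′) ≡ toℕ j + m →
    (i′ : Fin l) → toℕ i′ ≡ toℕ i →
    Space._≈ᴹ_ r (comp xy-z j′ (comp xy i x y) z) (comp xz-y i′ (comp xz j x z) y)
  Cl-parallel {m = m} {r = r} x y z xy xy-z xz xz-y i j i<j j′ j′≡ i′ i′≡ =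
    ≈ᴹ-byExtend R (B r)
      (comp xy-z j′ (comp xy i x y) z) (comp xz-y i′ (comp xz j x z) y) λ φ resp →
    trans (extend-bilinearˡ R (□ xy i) (□ xy-z j′) φ x y z)
    (trans (extend-cong R (λ u → trans
        (extend-cong R (λ v → extend-cong R (λ w →
          resp {□ xy-z j′ (□ xy i u v) w} {□ xz-y i′ (□ xz j u w) v} (word-≡ u v w)) z) y)
        -- The right-hand side sums over `z` before `y`, so the two inner sums are exchanged.
        (extend-swap R (λ v w → φ (□ xz-y i′ (□ xz j u w) v)) y z)) x)
      (sym (extend-bilinearˡ R (□ xz j) (□ xz-y i′) φ x z y)))
    where
    j′≡j+v : ∀ v → toℕ j′ ≡ toℕ j + length (word v)
    -- The successor in the hypothesis on `j′` cancels the one in `m`, which is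
    -- `suc (length (word v))`.
    j′≡j+v v = ℕ.suc-injective (≡.trans j′≡
      (≡.trans (cong (toℕ j +_) (≡.sym (size v))) (ℕ.+-suc (toℕ j) _)))

    word-≡ : ∀ u v w → insert (toℕ j′) (insert (toℕ i) (word u) (word v)) (word w) ≡
                       insert (toℕ i′) (insert (toℕ j) (word u) (word w)) (word v)
    word-≡ u v w = ≡.trans (cong (λ l → insert l _ (word w)) (j′≡j+v v))
      (≡.trans (insert-parallel (word u) (word v) (word w) (ℕ.<⇒≤ i<j) (position≤length u j))
        (cong (λ l → insert l _ (word v)) (≡.sym i′≡)))

  Cl-identityˡ : ∀ {n} (e : suc n ≡ 1 + n) x → Space._≈ᴹ_ n (comp e Fin.zero unit x) x
  Cl-identityˡ {n} e x = ≈ᴹ-byExtend R (B n) (comp e Fin.zero unit x) x λ φ resp →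
    trans (extend-bilinear R (□ e Fin.zero) φ unit x)
    (trans (extend-basis R (B 1) (λ u → extend R (λ v → φ (□ e Fin.zero u v)) x) ε)
      (extend-cong R (λ w → resp {□ e Fin.zero ε w} {w} (++-identityʳ (word w))) x))

  Cl-identityʳ : ∀ {n} (e : suc n ≡ n + 1) i x → Space._≈ᴹ_ n (comp e i x unit) x
  Cl-identityʳ {n} e i x = ≈ᴹ-byExtend R (B n) (comp e i x unit) x λ φ resp →
    trans (extend-bilinear R (□ e i) φ x unit)
      (extend-cong R (λ w → trans (extend-basis R (B 1) (λ v → φ (□ e i w v)) ε)
        (resp {□ e i w ε} {w} (take++drop≡id (toℕ i) (word w)))) x)

  Cl-isOperad : IsOperad (Cl R ρ ρ↗)
  Cl-isOperad = record
    { comp-cong  = λ {n} {m} {k} e i {x} {x′} {y} {y′} →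
        bilinear-cong R {A = B n} {B m} {B k} (□ e i)
          (λ {u} {u′} {v} {v′} → ≡.cong₂ (insert (toℕ i)) {word u} {word u′} {word v} {word v′})
          {x} {x′} {y} {y′}
    ; comp-+ˡ    = λ {n} {m} {k} e i → bilinear-+ˡ R {A = B n} {B m} {B k} (□ e i)
    ; comp-+ʳ    = λ {n} {m} {k} e i → bilinear-+ʳ R {A = B n} {B m} {B k} (□ e i)
    ; comp-*ˡ    = λ {n} {m} {k} e i → bilinear-*ˡ R {A = B n} {B m} {B k} (□ e i)
    ; comp-*ʳ    = λ {n} {m} {k} e i → bilinear-*ʳ R {A = B n} {B m} {B k} (□ e i)
    ; sequential = Cl-sequential
    ; parallel   = Cl-parallel
    ; identityˡ  = Cl-identityˡ
    ; identityʳ  = Cl-identityʳ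
    }

-- Quotient of an operad by an ideal

module _ {R : CommutativeRing c ℓ} (O : RawOperad R m ℓm) (V : GradedSubspace O p) where

  open RawOperad O
  open module Arity {n} = Module (Space n)
  open Submodule

  record IsIdeal : Set (c ⊔ m ⊔ p) where
    field
      compˡ-closed : ∀ {n m k} (e : suc k ≡ n + m) i {x} y →
                     Member (V n) x → Member (V k) (comp e i x y)
      compʳ-closed : ∀ {n m k} (e : suc k ≡ n + m) i x {y} →
                     Member (V m) y → Member (V k) (comp e i x y)

  quotient-isOperad : IsOperad O → IsIdeal → IsOperad (O /ᴼ V)
  quotient-isOperad isOperad isIdeal = record
    -- The arguments are changed one at a time, through `comp e i x′ y`. Each of the two differences
    -- is a composite with one factor in `V`.
    { comp-cong  = λ {n} {m} {k} e i {x} {x′} {y} {y′} x≈x′ y≈y′ → transᵠ (Space k) (V k)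
        (resp (V k) (comp-differenceˡ e i x x′ y) (compˡ-closed {n} {m} e i y x≈x′))
        (resp (V k) (comp-differenceʳ e i x′ y y′) (compʳ-closed {n} {m} e i x′ y≈y′))
    -- The remaining axioms already hold for representatives in `O`.
    ; comp-+ˡ    = λ {n} {m} e i x x′ y → ⌊ comp-+ˡ {n} {m} e i x x′ y ⌋
    ; comp-+ʳ    = λ {n} {m} e i x y y′ → ⌊ comp-+ʳ {n} {m} e i x y y′ ⌋
    ; comp-*ˡ    = λ {n} {m} e i a x y → ⌊ comp-*ˡ {n} {m} e i a x y ⌋
    ; comp-*ʳ    = λ {n} {m} e i a x y → ⌊ comp-*ʳ {n} {m} e i a x y ⌋
    ; sequential = λ x y z xy xy-z yz x-yz i j i+j i+j≡ →
        ⌊ sequential x y z xy xy-z yz x-yz i j i+j i+j≡ ⌋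
    ; parallel   = λ x y z xy xy-z xz xz-y i j i<j j′ j′≡ i′ i′≡ →
        ⌊ parallel x y z xy xy-z xz xz-y i j i<j j′ j′≡ i′ i′≡ ⌋
    ; identityˡ  = λ e x → ⌊ identityˡ e x ⌋
    ; identityʳ  = λ e i x → ⌊ identityʳ e i x ⌋
    }
    where
    open IsOperad isOperad
    open IsIdeal isIdeal

    ⌊_⌋ : ∀ {n} {x y : Carrierᴹ {n}} → x ≈ᴹ y → Member (V n) (x +ᴹ -ᴹ y)
    ⌊_⌋ {n} = ≈⇒≈ᵠ (Space n) (V n)

    cancel : ∀ {n} (x x′ : Carrierᴹ {n}) → (x +ᴹ -ᴹ x′) +ᴹ x′ ≈ᴹ x
    cancel {n} x x′ = //-rightDividesˡ x′ x
      where open import Algebra.Properties.Group (+ᴹ-group {n}) using (//-rightDividesˡ)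

    isolate : ∀ {n} (x y z : Carrierᴹ {n}) → x +ᴹ y ≈ᴹ z → x ≈ᴹ z +ᴹ -ᴹ y
    isolate {n} = x≈z//y
      where open import Algebra.Properties.Group (+ᴹ-group {n}) using (x≈z//y)

    -- Additivity is applied to `(x +ᴹ -ᴹ x′) +ᴹ x′`, which is `x`, and the second summand is then
    -- moved across; no separate law for negation is involved.
    comp-differenceˡ : ∀ {n m k} (e : suc k ≡ n + m) i x x′ y →
      comp e i (x +ᴹ -ᴹ x′) y ≈ᴹ comp e i x y +ᴹ -ᴹ comp e i x′ y
    comp-differenceˡ {n} {m} e i x x′ y = isolate _ _ _
      (≈ᴹ-trans (≈ᴹ-sym (comp-+ˡ {n} {m} e i _ x′ y)) (comp-cong {n} {m} e i (cancel x x′) ≈ᴹ-refl))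

    comp-differenceʳ : ∀ {n m k} (e : suc k ≡ n + m) i x y y′ →
      comp e i x (y +ᴹ -ᴹ y′) ≈ᴹ comp e i x y +ᴹ -ᴹ comp e i x y′
    comp-differenceʳ {n} {m} e i x y y′ = isolate _ _ _
      (≈ᴹ-trans (≈ᴹ-sym (comp-+ʳ {n} {m} e i x _ y′)) (comp-cong {n} {m} e i ≈ᴹ-refl (cancel y y′)))

-- Ideals given by spanning sets

module _ {R : CommutativeRing c ℓ} {O : RawOperad R m ℓm} (isOperad : IsOperad O) where

  open RawOperad O
  open module Arity′ {n} = Module (Space n)
  open IsOperad isOperad
  open CommutativeRing R using (0#)

  comp-0ˡ : ∀ {n m k} (e : suc k ≡ n + m) i y → comp e i 0ᴹ y ≈ᴹ 0ᴹ
  comp-0ˡ {n} {m} e i y = ≈ᴹ-trans (comp-cong {n} {m} e i (≈ᴹ-sym (*ₗ-zeroˡ 0ᴹ)) ≈ᴹ-refl)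
    (≈ᴹ-trans (comp-*ˡ {n} {m} e i 0# 0ᴹ y) (*ₗ-zeroˡ _))

  comp-0ʳ : ∀ {n m k} (e : suc k ≡ n + m) i x → comp e i x 0ᴹ ≈ᴹ 0ᴹ
  comp-0ʳ {n} {m} e i x = ≈ᴹ-trans (comp-cong {n} {m} e i ≈ᴹ-refl (≈ᴹ-sym (*ₗ-zeroˡ 0ᴹ)))
    (≈ᴹ-trans (comp-*ʳ {n} {m} e i 0# x 0ᴹ) (*ₗ-zeroˡ _))

  -- Induction on membership in the span: bilinearity carries each closure rule through `comp`,
  -- which leaves only the generators. The other argument stays arbitrary throughout.
  span-isIdeal : (G : ∀ n → Pred (Carrierᴹ {n}) p) →
    (∀ {n m k} (e : suc k ≡ n + m) i {x} y → G n x → Span (Space k) (G k) (comp e i x y)) →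
    (∀ {n m k} (e : suc k ≡ n + m) i x {y} → G m y → Span (Space k) (G k) (comp e i x y)) →
    IsIdeal O (λ n → span (Space n) (G n))
  span-isIdeal G genˡ genʳ = record { compˡ-closed = closedˡ ; compʳ-closed = closedʳ }
    where
    closedˡ : ∀ {n m k} (e : suc k ≡ n + m) i {x} y →
              Span (Space n) (G n) x → Span (Space k) (G k) (comp e i x y)
    closedˡ {n} {m} e i y (span-gen x∈G)       = genˡ e i y x∈G
    closedˡ {n} {m} e i y span-zero            = span-resp (≈ᴹ-sym (comp-0ˡ {n} {m} e i y)) span-zero
    closedˡ {n} {m} e i y (span-add x∈V x′∈V)  =
      span-resp (≈ᴹ-sym (comp-+ˡ {n} {m} e i _ _ y)) (span-add (closedˡ e i y x∈V) (closedˡ e i y x′∈V))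
    closedˡ {n} {m} e i y (span-mul k x∈V)     =
      span-resp (≈ᴹ-sym (comp-*ˡ {n} {m} e i k _ y)) (span-mul k (closedˡ e i y x∈V))
    closedˡ {n} {m} e i y (span-resp x≈x′ x∈V) =
      span-resp (comp-cong {n} {m} e i x≈x′ ≈ᴹ-refl) (closedˡ e i y x∈V)

    closedʳ : ∀ {n m k} (e : suc k ≡ n + m) i x {y} →
              Span (Space m) (G m) y → Span (Space k) (G k) (comp e i x y)
    closedʳ {n} {m} e i x (span-gen y∈G)       = genʳ e i x y∈G
    closedʳ {n} {m} e i x span-zero            = span-resp (≈ᴹ-sym (comp-0ʳ {n} {m} e i x)) span-zero
    closedʳ {n} {m} e i x (span-add y∈V y′∈V)  =
      span-resp (≈ᴹ-sym (comp-+ʳ {n} {m} e i x _ _)) (span-add (closedʳ e i x y∈V) (closedʳ e i x y′∈V))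
    closedʳ {n} {m} e i x (span-mul k y∈V)     =
      span-resp (≈ᴹ-sym (comp-*ʳ {n} {m} e i k x _)) (span-mul k (closedʳ e i x y∈V))
    closedʳ {n} {m} e i x (span-resp y≈y′ y∈V) =
      span-resp (comp-cong {n} {m} e i ≈ᴹ-refl y≈y′) (closedʳ e i x y∈V)

-- Letters of a subword inside the larger word

⊆⇒laterPosition : {A : Set a} {xs ys : List A} → xs ⊆ ys → (p : Fin (length xs)) →
                  Σ[ q ∈ Fin (length ys) ] toℕ p ≤ toℕ q × lookup xs p ≡ lookup ys q
-- A skipped letter of the larger word shifts the position one step to the right; a matched letter
-- does not shift it.
⊆⇒laterPosition (y ∷ʳ xs⊆ys) p with q , p≤q , eq ← ⊆⇒laterPosition xs⊆ys p =
  Fin.suc q , ℕ.m≤n⇒m≤1+n p≤q , eq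
⊆⇒laterPosition (x≡y ∷ xs⊆ys) Fin.zero = Fin.zero , z≤n , x≡y
⊆⇒laterPosition (x≡y ∷ xs⊆ys) (Fin.suc p) with q , p≤q , eq ← ⊆⇒laterPosition xs⊆ys p =
  Fin.suc q , s≤s p≤q , eq

⊆-insertˡ : ∀ i u v → u ⊆ insert i u v
⊆-insertˡ i u v = ⊆-trans (⊆-reflexive (≡.sym (take++drop≡id i u)))
  (++⁺ (⊆-refl {x = take i u}) (++⁺ˡ v ⊆-refl))

⊆-insertʳ : ∀ i u v → v ⊆ insert i u v
⊆-insertʳ i u v = ++⁺ˡ (take i u) (++⁺ʳ (drop i u) ⊆-refl)

-- Unimodality and the ideal of non-cliffs

module _ {δ : RangeMap} (unimodal : Unimodal δ) where

  -- If `a` exceeded `δ (suc p)`, so would `δ (suc q)`; an earlier value above `δ (suc p)` would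
  -- then create a valley. Hence `δ (suc p)` bounds the running maximum, which bounds `a`.
  unimodal-bound : ∀ {a p q} → p ≤ q → a ≤ bar δ (suc p) → a ≤ δ (suc q) → a ≤ δ (suc p)
  unimodal-bound {a} {p} {q} p≤q a≤bar a≤δq with ℕ.m≤n⇒m<n∨m≡n p≤q | a ℕ.≤? δ (suc p)
  ... | _         | yes a≤δp = a≤δp
  ... | inj₂ refl | no _     = a≤δq
  ... | inj₁ p<q  | no a≰δp  = ℕ.≤-trans a≤bar
    -- `z≤n` handles the default value 0 in `bar`.
    (max≤v⁺ z≤n (All.applyUpTo⁺₁ (λ r → δ (suc r)) (suc p) λ r<1+p → earlier (s≤s⁻¹ r<1+p)))
    where
    earlier : ∀ {r} → r ≤ p → δ (suc r) ≤ δ (suc p)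
    earlier {r} r≤p with ℕ.m≤n⇒m<n∨m≡n r≤p
    ... | inj₂ refl = ℕ.≤-refl
    ... | inj₁ r<p  = ℕ.≮⇒≥ λ δp<δr → unimodal (suc r) (suc p) (suc q) (s≤s r<p) (s≤s p<q)
      (δp<δr , ℕ.<-≤-trans (ℕ.≰⇒> a≰δp) a≤δq)

  -- The letter at `p` recurs in `w′` at some `q` not before `p`, and `unimodal-bound` carries its
  -- bound from `q` back to `p`. Used in contrapositive form: inserting cannot repair a violated
  -- bound.
  isCliff-⊆ : ∀ {w w′} → w ⊆ w′ → IsCliff (bar δ) w → IsCliff δ w′ → IsCliff δ w
  isCliff-⊆ w⊆w′ bar-cliff cliff p with q , p≤q , eq ← ⊆⇒laterPosition w⊆w′ p =
    unimodal-bound p≤q (bar-cliff p) (subst (_≤ _) (≡.sym eq) (cliff q))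

  module _ (R : CommutativeRing c ℓ) where

    open CommutativeRing R using (_≈_; _*_; 0#; 1#; +-congʳ; *-identityʳ) renaming (refl to ≈-refl)

    open RawOperad (Cl R (bar δ) (bar-weaklyIncreasing δ))

    private
      B : ℕ → DecSetoid _ _
      B = cliffDecSetoid (bar δ)

      NonCliff : ∀ n → Pred (Space.Carrierᴹ n) _
      NonCliff n x = Σ[ w ∈ Cliff (bar δ) n ] ¬ IsCliff δ (word w) × x ≡ basis R (B n) w

    ∈V : ∀ n → Space.Carrierᴹ n → Set _
    ∈V n = Submodule.Member (V R δ n)

    -- The generators of the span have coefficient `1#`, while products yield other coefficients.
    -- Scaling a generator gives `k * 1#`, which still has to be identified with `k`.
    V-monomial : ∀ {n} k (w : Cliff (bar δ) n) → ¬ IsCliff δ (word w) → ∈V n ((k , w) ∷ [])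
    V-monomial {n} k w w∉Cl = Submodule.resp (V R δ n)
      {scale R (B n) k (basis R (B n) w)} {(k , w) ∷ []}
      (λ i → +-congʳ (k*1≈k (does (DecSetoid._≟_ (B n) w i))))
      (Submodule.*-closed (V R δ n) k {basis R (B n) w} (span-gen (w , w∉Cl , refl)))
      where
      k*1≈k : ∀ t → (if t then k * 1# else 0#) ≈ (if t then k else 0#)
      k*1≈k true  = *-identityʳ k
      k*1≈k false = ≈-refl

    -- The composite has one monomial for each term of `y`, and the word of each contains `word w`
    -- as a subword, so `isCliff-⊆` keeps it outside the cliffs of `δ`.
    comp-basisˡ : ∀ {n m k} (e : suc k ≡ n + m) i w → ¬ IsCliff δ (word w) →
                  ∀ y → ∈V k (comp e i (basis R (B n) w) y)
    comp-basisˡ {k = k} e i w w∉Cl []            = Submodule.0-closed (V R δ k)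
    comp-basisˡ {n} {k = k} e i w w∉Cl ((l , v) ∷ y) = Submodule.+-closed (V R δ k)
      {(1# * l , insertCliff (bar-weaklyIncreasing δ) e i w v) ∷ []} {comp e i (basis R (B n) w) y}
      (V-monomial _ (insertCliff (bar-weaklyIncreasing δ) e i w v)
        (w∉Cl ∘ isCliff-⊆ (⊆-insertˡ (toℕ i) (word w) (word v)) (isCliff w)))
      (comp-basisˡ e i w w∉Cl y)

    comp-basisʳ : ∀ {n m k} (e : suc k ≡ n + m) i w → ¬ IsCliff δ (word w) →
                  ∀ x → ∈V k (comp e i x (basis R (B m) w))
    comp-basisʳ {k = k} e i w w∉Cl []            = Submodule.0-closed (V R δ k)
    comp-basisʳ {m = m} {k} e i w w∉Cl ((l , u) ∷ x) = Submodule.+-closed (V R δ k)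
      {(l * 1# , insertCliff (bar-weaklyIncreasing δ) e i u w) ∷ []} {comp e i x (basis R (B m) w)}
      (V-monomial _ (insertCliff (bar-weaklyIncreasing δ) e i u w)
        (w∉Cl ∘ isCliff-⊆ (⊆-insertʳ (toℕ i) (word u) (word w)) (isCliff w)))
      (comp-basisʳ e i w w∉Cl x)

    V-isIdeal : IsIdeal (Cl R (bar δ) (bar-weaklyIncreasing δ)) (V R δ)
    V-isIdeal = span-isIdeal {O = Cl R (bar δ) (bar-weaklyIncreasing δ)}
      (Cl-isOperad R (bar-weaklyIncreasing δ)) NonCliff genˡ genʳ
      where
      genˡ : ∀ {n m k} (e : suc k ≡ n + m) i {x} y → NonCliff n x → ∈V k (comp e i x y)
      genˡ e i y (w , w∉Cl , refl) = comp-basisˡ e i w w∉Cl y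

      genʳ : ∀ {n m k} (e : suc k ≡ n + m) i x {y} → NonCliff m y → ∈V k (comp e i x y)
      genʳ e i x (w , w∉Cl , refl) = comp-basisʳ e i w w∉Cl x

    Cl/V-isOperad : IsOperad (Cl R (bar δ) (bar-weaklyIncreasing δ) /ᴼ V R δ)
    Cl/V-isOperad = quotient-isOperad (Cl R (bar δ) (bar-weaklyIncreasing δ)) (V R δ)
      (Cl-isOperad R (bar-weaklyIncreasing δ)) V-isIdeal

theorem2p1p2 : ∀ {c ℓ₁ ℓ₂} (K : HeytingField c ℓ₁ ℓ₂) → CharacteristicZero K →
    (δ : RangeMap) → Unimodal δ →
    let R = HeytingField⇒CommutativeRing K in
    IsOperad (Cl R (bar δ) (bar-weaklyIncreasing δ) /ᴼ V R δ)
theorem2p1p2 K _ δ unimodal = Cl/V-isOperad {δ = δ} unimodal (HeytingField⇒CommutativeRing K)
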